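{- Let $m$ be a positive integer. Then there exists a highly composite number $N$ such that $m!\mid N$.
   Context: A positive integer $N$ is highly composite if $d(k)<d(N)$ for every positive integer $k<N$, where $d$ is the number-of-divisors function. -}

module Defs where

open import Data.List.Base using (List; applyUpTo; filter; length)
open import Data.Nat.Base using (ℕ; suc; _<_; NonZero)
open import Data.Nat.Divisibility using (_∣?_)
open import Data.Product.Base using (_×_)

-- applyUpTo suc n enumerates 1, …, n, so for n ≥ 1 these are exactly the
-- positive divisors of n, each listed once.  (divisors 0 is the empty list.)
divisors : ℕ → List ℕ
divisors n = filter (_∣? n) (applyUpTo suc n)

d : ℕ → ℕ
d n = length (divisors n)

HighlyComposite : ℕ → Set
HighlyComposite N = NonZero N × (∀ k → .{{_ : NonZero k}} → k < N → d k < d N)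

{-# OPTIONS --safe #-}
-- A highly composite N > B exists for every B: the least N with d N > B.  Now fix L = m ! and
-- suppose p ^ k divides L but not the highly composite N.  Multiplying N by p ^ k at least
-- doubles its number of divisors, while dividing by q ^ c at most halves it when
-- q ^ (2c − 1) ∣ N.  Since N is minimal for its number of divisors, this forces
-- q ^ (2c − 1) ∤ N for every prime q ≠ p and every c with p ^ k < q ^ c.  So all primes of N
-- are ≤ L (c = 1) and all exponents are ≤ 2L (c = L + 1; the exponent of p is < k), whence
-- N divides (L !) ^ (2L) and N is bounded.
module Submission where

open import Data.Nat.Base
open import Data.Nat.Properties
open import Data.Nat.Divisibility
open import Data.Nat.Induction using (<-rec)
open import Data.Nat.ListAction using (product)
open import Data.Nat.Primality
open import Data.Nat.Primality.Factorisation using (PrimeFactorisation; factorise)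
open import Data.Nat.Tactic.RingSolver using (solve-∀)
open import Data.List.Base using (List; []; _∷_; _++_; applyUpTo; length; map)
open import Data.List.Properties using (length-filter; length-applyUpTo; length-map; length-++)
open import Data.List.Membership.Propositional using (_∈_)
open import Data.List.Membership.Propositional.Properties
open import Data.List.Membership.Propositional.Properties.WithK using (unique∧set⇒bag)
open import Data.List.Relation.Binary.BagAndSetEquality using (∼bag⇒↭)
open import Data.List.Relation.Binary.Permutation.Propositional.Properties using (↭-length)
open import Data.List.Relation.Unary.All using (All; []; _∷_)
open import Data.List.Relation.Unary.Unique.Propositional using (Unique)
import Data.List.Relation.Unary.Unique.Propositional.Properties as Unique
open import Data.Product.Base using (∃-syntax; _×_; _,_; proj₂)
open import Data.Sum.Base using (inj₁; inj₂; [_,_]′)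
open import Function.Base using (_∘_; id; case_of_)
open import Function.Bundles using (mk⇔)
open import Relation.Binary.PropositionalEquality
open import Relation.Nullary using (¬_; yes; no; contradiction)
open import Relation.Unary using (Decidable)
open import Defs

private variable
  k m n p q : ℕ

-- Prime powers and divisibility.

prime∣^⇒∣ : Prime p → ∀ k → p ∣ m ^ k → p ∣ m
prime∣^⇒∣ pp zero    p∣1 = contradiction (subst Prime (∣1⇒≡1 p∣1) pp) ¬prime[1]
prime∣^⇒∣ {m = m} pp (suc k) p∣ =
  [ id , prime∣^⇒∣ pp k ]′ (euclidsLemma m (m ^ k) pp p∣)

prime∣prime⇒≡ : Prime p → Prime q → p ∣ q → p ≡ q
prime∣prime⇒≡ pp pq p∣q with prime⇒irreducible pq p∣q
... | inj₁ refl = contradiction pp ¬prime[1]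
... | inj₂ p≡q  = p≡q

^∣*∧∤⇒^∣ : Prime p → p ∤ n → ∀ k {m} → p ^ k ∣ m * n → p ^ k ∣ m
^∣*∧∤⇒^∣ pp p∤n zero {m} _ = 1∣ m
^∣*∧∤⇒^∣ {p} {n} pp p∤n (suc k) {m} p^∣mn
  with euclidsLemma m n pp (m*n∣⇒m∣ p (p ^ k) p^∣mn)
... | inj₂ p∣n = contradiction p∣n p∤n
... | inj₁ (divides-refl m′) =
  subst (p * p ^ k ∣_) (*-comm p m′) (*-monoʳ-∣ p (^∣*∧∤⇒^∣ pp p∤n k p^∣m′n))
  where
  instance _ = prime⇒nonZero pp
  p^∣m′n : p ^ k ∣ m′ * n
  p^∣m′n = *-cancelˡ-∣ p (subst (p * p ^ k ∣_) (trans (cong (_* n) (*-comm m′ p)) (*-assoc p m′ n)) p^∣mn)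

^-monoʳ-∣ : ∀ m {j k} → j ≤ k → m ^ j ∣ m ^ k
^-monoʳ-∣ m {j} {k} j≤k = divides (m ^ (k ∸ j))
  (trans (cong (m ^_) (sym (m∸n+n≡m j≤k))) (^-distribˡ-+-* m (k ∸ j) j))

^-monoˡ-∣ : ∀ k → m ∣ n → m ^ k ∣ n ^ k
^-monoˡ-∣ zero    _   = ∣-refl
^-monoˡ-∣ (suc k) m∣n = *-pres-∣ m∣n (^-monoˡ-∣ k m∣n)

∤^*⇒≤ : Prime p → ∀ {j k} → p ∤ n → p ^ k ∣ p ^ j * n → k ≤ j
∤^*⇒≤ {p} {n} pp {j} {k} p∤n p^k∣ = ≮⇒≥ λ j<k →
  <⇒≱ (^-monoʳ-< p (nonTrivial⇒n>1 p) j<k) (∣⇒≤ (^∣*∧∤⇒^∣ pp p∤n k p^k∣))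
  where instance
    _ = prime⇒nonZero pp
    _ = prime⇒nonTrivial pp
    _ = m^n≢0 p j

removePrime : Prime p → ∀ n → .{{_ : NonZero n}} → ∃[ a ] ∃[ r ] (n ≡ p ^ a * r × p ∤ r)
removePrime {p} pp = <-rec (λ n → .{{_ : NonZero n}} → ∃[ a ] ∃[ r ] (n ≡ p ^ a * r × p ∤ r)) step
  where
  instance _ = prime⇒nonTrivial pp
  step : ∀ n → (∀ {m} → m < n → .{{_ : NonZero m}} → ∃[ a ] ∃[ r ] (m ≡ p ^ a * r × p ∤ r)) →
         .{{_ : NonZero n}} → ∃[ a ] ∃[ r ] (n ≡ p ^ a * r × p ∤ r)
  step n rec with p ∣? n
  ... | no p∤n  = 0 , n , sym (*-identityˡ n) , p∤n
  ... | yes p∣n with rec (quotient-< p∣n) {{quotient≢0 p∣n}}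
  ...   | a , r , eq , p∤r =
    suc a , r , trans (m∣n⇒n≡m*quotient p∣n) (trans (cong (p *_) eq) (sym (*-assoc p (p ^ a) r))) , p∤r

-- Induction on the prime factorisation of `m`: each prime of the list is cancelled from both sides,
-- so the hypothesis must be carried over to the cofactor `n′`.
primePowers-∣⇒∣ : ∀ m {n} → .{{_ : NonZero m}} →
                  (∀ {p} k → Prime p → p ^ k ∣ m → p ^ k ∣ n) → m ∣ n
primePowers-∣⇒∣ m {n} h = subst (_∣ n) (sym isFactorisation)
  (go factors factorsPrime n (λ k pp → h k pp ∘ subst (_ ∣_) (sym isFactorisation)))
  where
  open PrimeFactorisation (factorise m)
  go : ∀ ps → All Prime ps → ∀ n →
       (∀ {p} k → Prime p → p ^ k ∣ product ps → p ^ k ∣ n) → product ps ∣ n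
  go []       _          n h = 1∣ n
  go (p ∷ ps) (pp ∷ pps) n h
    with h 1 pp (subst (_∣ p * product ps) (sym (*-identityʳ p)) (m∣m*n (product ps)))
  ... | p∣n with subst (_∣ n) (*-identityʳ p) p∣n
  ...   | divides-refl n′ = subst (p * product ps ∣_) (*-comm p n′) (*-monoʳ-∣ p (go ps pps n′ h′))
    where
    instance _ = prime⇒nonZero pp
    h′ : ∀ {q} k → Prime q → q ^ k ∣ product ps → q ^ k ∣ n′
    h′ {q} k pq q^k∣ with p ≟ q
    -- Cancelling `p` costs one power of `p`, so the hypothesis is used at exponent `suc k`; for `q`
    -- other than `p` nothing is lost.
    ... | yes refl = *-cancelˡ-∣ p (subst (p ^ suc k ∣_) (*-comm n′ p) (h (suc k) pp (*-monoʳ-∣ p q^k∣)))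
    ... | no p≢q   = ^∣*∧∤⇒^∣ pq (p≢q ∘ sym ∘ prime∣prime⇒≡ pq pp) k (h k pq (∣n⇒∣m*n p q^k∣))

-- Counting divisors.

∈-divisors⁺ : .{{_ : NonZero n}} → k ∣ n → k ∈ divisors n
∈-divisors⁺ {suc n} {zero}  0∣n = contradiction (0∣⇒≡0 0∣n) λ ()
∈-divisors⁺ {n}     {suc k} k∣n = ∈-filter⁺ (_∣? n) (∈-applyUpTo⁺ suc (∣⇒≤ k∣n)) k∣n

∈-divisors⁻ : k ∈ divisors n → k ∣ n
∈-divisors⁻ {n = n} k∈ = proj₂ (∈-filter⁻ (_∣? n) {xs = applyUpTo suc n} k∈)

divisors-unique : ∀ n → Unique (divisors n)
divisors-unique n = Unique.filter⁺ (_∣? n)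
  (Unique.applyUpTo⁺₁ suc n (λ i<j _ → <⇒≢ i<j ∘ suc-injective))

d≤ : ∀ n → d n ≤ n
d≤ n = ≤-trans (length-filter (_∣? n) (applyUpTo suc n)) (≤-reflexive (length-applyUpTo suc n))

-- A divisor of `p ^ suc a * n` either divides `p ^ a * n` or is `p ^ suc a` times a divisor of `n`.
-- Both lists are duplicate-free and they are disjoint, so their concatenation is a permutation of
-- the divisor list.
d-prime^suc : Prime p → ∀ a n → .{{_ : NonZero n}} → p ∤ n →
              d (p ^ suc a * n) ≡ d (p ^ a * n) + d n
d-prime^suc {p} pp a n p∤n = begin
  length (divisors (p ^ suc a * n))
    ≡⟨ ↭-length (∼bag⇒↭ (unique∧set⇒bag (divisors-unique (p ^ suc a * n)) unique (mk⇔ to from))) ⟩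
  length (divisors (p ^ a * n) ++ map (p ^ suc a *_) (divisors n))
    ≡⟨ length-++ (divisors (p ^ a * n)) ⟩
  d (p ^ a * n) + length (map (p ^ suc a *_) (divisors n))
    ≡⟨ cong (d (p ^ a * n) +_) (length-map (p ^ suc a *_) (divisors n)) ⟩
  d (p ^ a * n) + d n ∎
  where
  open ≡-Reasoning
  instance
    _ = prime⇒nonZero pp
    _ = prime⇒nonTrivial pp
    _ = m^n≢0 p a
    _ = m^n≢0 p (suc a)
    _ = m*n≢0 (p ^ a) n
    _ = m*n≢0 (p ^ suc a) n
  unique : Unique (divisors (p ^ a * n) ++ map (p ^ suc a *_) (divisors n))
  unique = Unique.++⁺ (divisors-unique (p ^ a * n))
    (Unique.map⁺ (*-cancelˡ-≡ _ _ (p ^ suc a)) (divisors-unique n))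
    -- A common element would make `p ^ suc a` divide `p ^ a * n`, forcing `suc a ≤ a`.
    λ (x∈ , x∈′) → case ∈-map⁻ (p ^ suc a *_) x∈′ of λ where
      (e , _ , refl) → 1+n≰n (∤^*⇒≤ pp {j = a} p∤n (m*n∣⇒m∣ (p ^ suc a) e (∈-divisors⁻ x∈)))
  to : ∀ {x} → x ∈ divisors (p ^ suc a * n) →
       x ∈ divisors (p ^ a * n) ++ map (p ^ suc a *_) (divisors n)
  to {x} x∈ with ∈-divisors⁻ {n = p ^ suc a * n} x∈
  -- If `p` divides the cofactor of `x`, one `p` cancels and `x` divides `p ^ a * n`; otherwise all
  -- of `p ^ suc a` lies in `x`.
  ... | x∣ with p ∣? quotient x∣
  ...   | yes (divides y′ y≡) = ∈-++⁺ˡ (∈-divisors⁺ (divides y′ (*-cancelˡ-≡ _ _ p (begin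
      p * (p ^ a * n)  ≡⟨ *-assoc p (p ^ a) n ⟨
      p ^ suc a * n    ≡⟨ _∣_.equality x∣ ⟩
      quotient x∣ * x  ≡⟨ cong (_* x) y≡ ⟩
      y′ * p * x       ≡⟨ cong (_* x) (*-comm y′ p) ⟩
      p * y′ * x       ≡⟨ *-assoc p y′ x ⟩
      p * (y′ * x)     ∎))))
  ...   | no p∤y
    with ^∣*∧∤⇒^∣ pp p∤y (suc a) (divides n (trans (sym (m∣n⇒n≡m*quotient x∣)) (*-comm (p ^ suc a) n)))
  ...     | p^∣x = subst (_∈ _) (sym (m∣n⇒n≡m*quotient p^∣x))
      (∈-++⁺ʳ (divisors (p ^ a * n)) (∈-map⁺ (p ^ suc a *_) (∈-divisors⁺
        (*-cancelˡ-∣ (p ^ suc a) (subst (_∣ p ^ suc a * n) (m∣n⇒n≡m*quotient p^∣x) x∣)))))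
  from : ∀ {x} → x ∈ divisors (p ^ a * n) ++ map (p ^ suc a *_) (divisors n) →
         x ∈ divisors (p ^ suc a * n)
  from x∈ with ∈-++⁻ (divisors (p ^ a * n)) x∈
  ... | inj₁ x∈ˡ = ∈-divisors⁺ (∣-trans (∈-divisors⁻ x∈ˡ) (*-monoˡ-∣ n (n∣m*n p)))
  ... | inj₂ x∈ʳ with ∈-map⁻ (p ^ suc a *_) x∈ʳ
  ...   | e , e∈ , refl = ∈-divisors⁺ (*-monoʳ-∣ (p ^ suc a) (∈-divisors⁻ e∈))

d-prime^ : Prime p → ∀ a n → .{{_ : NonZero n}} → p ∤ n → d (p ^ a * n) ≡ suc a * d n
d-prime^ pp zero    n p∤n = trans (cong d (*-identityˡ n)) (sym (*-identityˡ (d n)))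
d-prime^ {p} pp (suc a) n p∤n = begin
  d (p ^ suc a * n)   ≡⟨ d-prime^suc pp a n p∤n ⟩
  d (p ^ a * n) + d n ≡⟨ cong (_+ d n) (d-prime^ pp a n p∤n) ⟩
  suc a * d n + d n   ≡⟨ +-comm (suc a * d n) (d n) ⟩
  suc (suc a) * d n   ∎
  where open ≡-Reasoning

-- Highly composite numbers: unboundedness and exchange.

least : ∀ {P : ℕ → Set} → Decidable P → ∀ n → P n → ∃[ l ] (P l × (∀ k → k < l → ¬ P k))
least {P} P? = <-rec (λ n → P n → ∃[ l ] (P l × (∀ k → k < l → ¬ P k))) step
  where
  step : ∀ n → (∀ {m} → m < n → P m → _) → P n → ∃[ l ] (P l × (∀ k → k < l → ¬ P k))
  step n rec Pn with anyUpTo? P? n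
  ... | yes (m , m<n , Pm) = rec m<n Pm
  ... | no none            = n , Pn , λ k k<n Pk → none (k , k<n , Pk)

highlyComposite-unbounded : ∀ B → ∃[ N ] (HighlyComposite N × B < N)
-- `2 ^ B` has `suc B` divisors; the factor 1 gives it the shape of `d-prime^`.
highlyComposite-unbounded B with least (λ n → B <? d n) (2 ^ B * 1) B<d[2^B]
  where
  B<d[2^B] : B < d (2 ^ B * 1)
  B<d[2^B] = ≤-reflexive (sym (trans (d-prime^ prime[2] B 1 (λ 2∣1 → case ∣1⇒≡1 2∣1 of λ ())) (*-identityʳ (suc B))))
... | N , B<dN , minimal =
  N , (>-nonZero (≤-<-trans z≤n B<N) , λ k k<N → ≤-<-trans (≮⇒≥ (minimal k k<N)) B<dN) , B<N
  where
  B<N : B < N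
  B<N = <-≤-trans B<dN (d≤ N)

-- Otherwise `N` is `p ^ a * (q ^ b * r)` with `a < A`. Trading `q ^ suc e` for `p ^ A` yields a
-- smaller `N′`, yet `suc a` at least doubles and `suc b` at most halves, so `d N′` is not below
-- `d N`.
highlyComposite-exchange : ∀ {N} → HighlyComposite N → Prime p → Prime q → p ≢ q → ∀ A e →
  p ^ A < q ^ suc e → q ^ suc (e + e) ∣ N → p ^ A ∣ N
highlyComposite-exchange {p} {q} {N} (N≢0 , max) pp pq p≢q A e p^A<q^ q^∣N
  with removePrime pp N {{N≢0}}
... | a , n , refl , p∤n with A ≤? a
...   | yes A≤a = ∣m⇒∣m*n n (^-monoʳ-∣ p A≤a)
...   | no  A≰a with removePrime pq n {{m*n≢0⇒n≢0 (p ^ a) {{N≢0}}}}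
...     | b , r , refl , q∤r = contradiction (max N′ N′<N) (≤⇒≯ dN≤dN′)
  where
  instance
    _ = prime⇒nonZero pp
    _ = prime⇒nonZero pq
    _ = m*n≢0⇒n≢0 (q ^ b) {{m*n≢0⇒n≢0 (p ^ a) {{N≢0}}}}
  1+2e≤b : suc (e + e) ≤ b
  1+2e≤b = ∤^*⇒≤ pq q∤r (^∣*∧∤⇒^∣ pq (p≢q ∘ sym ∘ prime∣prime⇒≡ pq pp ∘ prime∣^⇒∣ pq a) (suc (e + e))
    (subst (q ^ suc (e + e) ∣_) (*-comm (p ^ a) _) q^∣N))
  -- `f` is the exponent of `q` left in `N′`, namely `b` minus `suc e`. Writing it as `e + c`
  -- exposes `e ≤ f`, which is what `suc-b≤` needs.
  c f : ℕ
  c = b ∸ suc (e + e)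
  f = e + c
  b≡ : b ≡ suc e + f
  b≡ = trans (sym (m+[n∸m]≡n 1+2e≤b)) (+-assoc (suc e) e c)
  X N′ : ℕ
  X = p ^ a * (q ^ f * r)
  N′ = p ^ (A + a) * (q ^ f * r)
  instance
    _ = m^n≢0 p a
    _ = m^n≢0 q f
    _ = m^n≢0 q b
    _ = m^n≢0 p (A + a)
    _ = m*n≢0 (q ^ f) r
    _ = m*n≢0 (q ^ b) r
    _ = m*n≢0 (p ^ a) (q ^ f * r)
    _ = m*n≢0 (p ^ (A + a)) (q ^ f * r)
  rearrange : ∀ w x y z → w * (x * y * z) ≡ x * (w * (y * z))
  rearrange = solve-∀
  N′<N : N′ < p ^ a * (q ^ b * r)
  N′<N = begin-strict
    p ^ (A + a) * (q ^ f * r)           ≡⟨ cong (_* (q ^ f * r)) (^-distribˡ-+-* p A a) ⟩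
    p ^ A * p ^ a * (q ^ f * r)         ≡⟨ *-assoc (p ^ A) (p ^ a) _ ⟩
    p ^ A * X                           <⟨ *-monoˡ-< X p^A<q^ ⟩
    q ^ suc e * X                       ≡⟨ rearrange (p ^ a) (q ^ suc e) (q ^ f) r ⟨
    p ^ a * (q ^ suc e * q ^ f * r)     ≡⟨ cong (λ z → p ^ a * (z * r)) (^-distribˡ-+-* q (suc e) f) ⟨
    p ^ a * (q ^ (suc e + f) * r)       ≡⟨ cong (λ z → p ^ a * (q ^ z * r)) b≡ ⟨
    p ^ a * (q ^ b * r)                 ∎
    where open ≤-Reasoning
  p∤q^f*r : p ∤ q ^ f * r
  p∤q^f*r p∣ = [ p≢q ∘ prime∣prime⇒≡ pp pq ∘ prime∣^⇒∣ pp f , p∤n ∘ ∣n⇒∣m*n (q ^ b) ]′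
    (euclidsLemma (q ^ f) r pp p∣)
  suc-b≤ : suc b ≤ 2 * suc f
  suc-b≤ = begin
    suc b                ≡⟨ cong suc b≡ ⟩
    suc (suc e + f)      ≤⟨ s≤s (s≤s (+-monoˡ-≤ f (m≤m+n e c))) ⟩
    suc (suc f + f)      ≡⟨ double f ⟩
    2 * suc f            ∎
    where
    open ≤-Reasoning
    double : ∀ x → suc (suc x + x) ≡ 2 * suc x
    double = solve-∀
  suc-a≤ : suc a * 2 ≤ suc (A + a)
  suc-a≤ = begin
    suc a * 2         ≡⟨ double a ⟩
    suc a + suc a     ≤⟨ +-monoˡ-≤ (suc a) (≰⇒> A≰a) ⟩
    A + suc a         ≡⟨ +-suc A a ⟩
    suc (A + a)       ∎
    where
    open ≤-Reasoning
    double : ∀ x → suc x * 2 ≡ suc x + suc x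
    double = solve-∀
  dN≤dN′ : d (p ^ a * (q ^ b * r)) ≤ d N′
  dN≤dN′ = begin
    d (p ^ a * (q ^ b * r))          ≡⟨ d-prime^ pp a (q ^ b * r) p∤n ⟩
    suc a * d (q ^ b * r)            ≡⟨ cong (suc a *_) (d-prime^ pq b r q∤r) ⟩
    suc a * (suc b * d r)            ≤⟨ *-monoʳ-≤ (suc a) (*-monoˡ-≤ (d r) suc-b≤) ⟩
    suc a * (2 * suc f * d r)        ≡⟨ assoc (suc a) 2 (suc f) (d r) ⟩
    suc a * 2 * (suc f * d r)        ≤⟨ *-monoˡ-≤ (suc f * d r) suc-a≤ ⟩
    suc (A + a) * (suc f * d r)      ≡⟨ cong (suc (A + a) *_) (d-prime^ pq f r q∤r) ⟨
    suc (A + a) * d (q ^ f * r)      ≡⟨ d-prime^ pp (A + a) (q ^ f * r) p∤q^f*r ⟨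
    d N′                             ∎
    where
    open ≤-Reasoning
    assoc : ∀ w x y z → w * (x * y * z) ≡ w * x * (y * z)
    assoc = solve-∀

-- Bounding highly composite numbers that miss a prime power of `L`.

n<m^n : ∀ m n → 1 < m → n < m ^ n
n<m^n m zero    _   = z<s
n<m^n m (suc n) 1<m = ≤-<-trans (n<m^n m n 1<m) (^-monoʳ-< m 1<m (n<1+n n))

n∣n! : ∀ n → .{{_ : NonZero n}} → n ∣ n !
n∣n! (suc n) = m∣m*n (n !)

large-highlyComposite-∣ : ∀ L → .{{_ : NonZero L}} → ∀ {N} → HighlyComposite N →
  (L !) ^ (L + L) < N → L ∣ N
large-highlyComposite-∣ L {N} hc@(N≢0 , _) B<N = primePowers-∣⇒∣ L primePower-∣
  where
  instance
    _ = N≢0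
    _ = L !≢0
    _ = m^n≢0 (L !) (L + L)
  primePower-∣ : ∀ {p} k → Prime p → p ^ k ∣ L → p ^ k ∣ N
  primePower-∣ {p} k pp p^k∣L with p ^ k ∣? N
  ... | yes p^k∣N = p^k∣N
  ... | no  p^k∤N = contradiction (∣⇒≤ (primePowers-∣⇒∣ N N-primePower-∣)) (<⇒≱ B<N)
    where
    p^k≤L : p ^ k ≤ L
    p^k≤L = ∣⇒≤ p^k∣L
    N-primePower-∣ : ∀ {q} j → Prime q → q ^ j ∣ N → q ^ j ∣ (L !) ^ (L + L)
    N-primePower-∣ zero _ _ = 1∣ _
    N-primePower-∣ {q} (suc j) pq q^∣N =
      -- From `q ≤ L`, `q` divides `q !` and hence `L !`.
      ∣-trans (^-monoˡ-∣ (suc j) (∣-trans (n∣n! q) (m≤n⇒m!∣n! q≤L))) (^-monoʳ-∣ (L !) j+1≤2L)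
      where
      instance
        _ = prime⇒nonZero pq
        _ = prime⇒nonTrivial pq
      1<q : 1 < q
      1<q = nonTrivial⇒n>1 q
      -- The exchange needs distinct primes; for `p` itself the exponent bound comes directly from
      -- `p ^ k ∤ N`.
      p≡q⇒j<k : p ≡ q → suc j < k
      p≡q⇒j<k refl = ≰⇒> λ k≤j → p^k∤N (∣-trans (^-monoʳ-∣ p k≤j) q^∣N)
      no-exchange : p ≢ q → ∀ e → p ^ k < q ^ suc e → suc (e + e) ≰ suc j
      no-exchange p≢q e p^k<q^ 1+2e≤j = p^k∤N
        (highlyComposite-exchange hc pp pq p≢q k e p^k<q^ (∣-trans (^-monoʳ-∣ q 1+2e≤j) q^∣N))
      q≤L : q ≤ L
      q≤L with p ≟ q
      ... | yes refl = begin
        p       ≡⟨ *-identityʳ p ⟨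
        p ^ 1   ≤⟨ ^-monoʳ-≤ p (≤-trans (s≤s z≤n) (<⇒≤ (p≡q⇒j<k refl))) ⟩
        p ^ k   ≤⟨ p^k≤L ⟩
        L       ∎
        where open ≤-Reasoning
      -- With `e = 0` the exchange forbids any power of a prime `q` exceeding `L`, since then
      -- `p ^ k ≤ L < q`.
      ... | no p≢q = ≮⇒≥ λ L<q → no-exchange p≢q 0
        (≤-<-trans p^k≤L (<-≤-trans L<q (≤-reflexive (sym (*-identityʳ q))))) (s≤s z≤n)
      j+1≤2L : suc j ≤ L + L
      j+1≤2L with p ≟ q
      ... | yes refl = begin
        suc j   ≤⟨ <⇒≤ (p≡q⇒j<k refl) ⟩
        k       ≤⟨ <⇒≤ (n<m^n p k 1<q) ⟩
        p ^ k   ≤⟨ p^k≤L ⟩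
        L       ≤⟨ m≤m+n L L ⟩
        L + L   ∎
        where open ≤-Reasoning
      -- With `e = L`, `p ^ k ≤ L < q ^ suc L`, so the forbidden exponent is `suc (L + L)`.
      ... | no p≢q = ≮⇒≥ (no-exchange p≢q L
        (≤-<-trans p^k≤L (<-trans (n<1+n L) (n<m^n q (suc L) 1<q))))

proposition57 : (m : ℕ) → .{{_ : NonZero m}} → ∃[ N ] (HighlyComposite N × (m !) ∣ N)
-- The double factorial is `L !` for `L = m !`.
proposition57 m with highlyComposite-unbounded (((m !) !) ^ (m ! + m !))
... | N , hc , B<N = N , hc , large-highlyComposite-∣ (m !) {{m !≢0}} hc B<N
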